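{- Let $r\ge 3$ be an integer, let $\varepsilon>0$, and let $G$ be an $n$-vertex $K_r$-free graph. Suppose that for every pair of non-adjacent vertices $u,v\in V(G)$, the induced subgraph $G[N(u)\cap N(v)]$ contains at least $\varepsilon n^{r-2}$ copies of $K_{r-2}$. Then $\chi(G)\le C$, where $C=C(r,\varepsilon)$ depends only on $r$ and $\varepsilon$ (and not on $n$ or $G$).
   Context: $N(u)$ denotes the set of neighbors of $u$ in $G$; $\chi(G)$ is the chromatic number of $G$. -}

module Defs where

open import Level using (0ℓ)
open import Data.Nat using (ℕ; zero; suc; _≤_; z≤n; s≤s; _^_)
import Data.Nat as ℕ
open import Data.Integer using (+_)
open import Data.Rational using (ℚ; 0ℚ; _/_)
import Data.Rational as ℚ
open import Data.Fin using (Fin)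
open import Data.Fin.Base using (funToFin; finToFun)
open import Data.Fin.Properties using (_≟_; all?; any?; finToFun-funToFin)
open import Data.Fin.Subset using (Subset; inside; outside; _∈_; _⊆_; ∣_∣)
open import Data.Fin.Subset.Properties using (_∈?_; _⊆?_)
open import Data.List using (List; []; _∷_; _++_; map; filter; length)
open import Data.Product using (∃; ∃-syntax; _×_; _,_; proj₁; proj₂)
open import Data.Sum using (_⊎_)
open import Data.Vec using (tabulate)
import Data.Vec as Vec
open import Function using (_∘_; id)
open import Relation.Binary using (Rel; Decidable; Symmetric; Irreflexive)
open import Relation.Binary.PropositionalEquality
  using (_≡_; _≢_; _≗_; refl; sym; trans)
open import Relation.Nullary using (¬_; Dec; yes; no; does; contradiction)
open import Relation.Nullary.Decidable using (map′; ¬?; _×-dec_; _→-dec_)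
import Relation.Unary as U

-- Dedekind reals: Lower q means q < x and Upper q means x < q.
record ℝ : Set₁ where
  field
    Lower Upper   : U.Pred ℚ 0ℓ
    lower-nonempty : ∃ Lower
    upper-nonempty : ∃ Upper
    lower-closed   : ∀ {p q} → p ℚ.< q → Lower q → Lower p
    lower-open     : ∀ {p} → Lower p → ∃[ q ] p ℚ.< q × Lower q
    upper-closed   : ∀ {p q} → p ℚ.< q → Upper p → Upper q
    upper-open     : ∀ {q} → Upper q → ∃[ p ] p ℚ.< q × Upper p
    disjoint       : ∀ {q} → ¬ (Lower q × Upper q)
    located        : ∀ {p q} → p ℚ.< q → Lower p ⊎ Upper q

Positive : ℝ → Set
Positive x = ℝ.Lower x 0ℚ

ℕ→ℚ : ℕ → ℚ
ℕ→ℚ m = + m / 1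

-- x · m ≤ k for a real x and naturals m, k.  Since m ≥ 0, this inequality
-- holds exactly when q m ≤ k for every rational q < x.
_·_≤ᴿ_ : ℝ → ℕ → ℕ → Set
x · m ≤ᴿ k = ∀ q → ℝ.Lower x q → q ℚ.* ℕ→ℚ m ℚ.≤ ℕ→ℚ k

infix 4 _·_≤ᴿ_

record Graph (n : ℕ) : Set₁ where
  field
    Adj    : Rel (Fin n) 0ℓ
    adj?   : Decidable Adj
    symm   : Symmetric Adj
    irrefl : Irreflexive _≡_ Adj

module _ {n : ℕ} (G : Graph n) where
  open Graph G

  N : Fin n → Subset n
  N u = tabulate (λ v → does (adj? u v))

  IsClique : ℕ → Subset n → Set
  IsClique k S =
    ∣ S ∣ ≡ k × (∀ i j → i ∈ S → j ∈ S → i ≢ j → Adj i j)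

  isClique? : ∀ k → U.Decidable (IsClique k)
  isClique? k S =
    (∣ S ∣ ℕ.≟ k) ×-dec
    all? λ i → all? λ j →
      (i ∈? S) →-dec ((j ∈? S) →-dec (¬? (i ≟ j) →-dec adj? i j))

  KFree : ℕ → Set
  KFree r = ∀ S → ¬ IsClique r S

subsets : ∀ n → List (Subset n)
subsets zero    = Vec.[] ∷ []
subsets (suc n) =
  map (inside Vec.∷_) (subsets n) ++ map (outside Vec.∷_) (subsets n)

-- The number of copies of K_k in the induced subgraph G[W], a copy being
-- identified with its vertex set.
copiesIn : ∀ {n} → Graph n → Subset n → ℕ → ℕ
copiesIn {n} G W k =
  length (filter (λ S → (S ⊆? W) ×-dec isClique? G k S) (subsets n))

module _ {n : ℕ} (G : Graph n) where
  open Graph G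

  Proper : ∀ {k} → (Fin n → Fin k) → Set
  Proper c = ∀ i j → Adj i j → c i ≢ c j

  Colourable : ℕ → Set
  Colourable k = ∃[ c ] Proper {k} c

  proper? : ∀ {k} → U.Decidable (Proper {k})
  proper? c = all? λ i → all? λ j → adj? i j →-dec ¬? (c i ≟ c j)

  proper-resp-≗ : ∀ {k} {c d : Fin n → Fin k} → c ≗ d → Proper d → Proper c
  proper-resp-≗ c≗d pd i j a ci≡cj =
    pd i j a (trans (sym (c≗d i)) (trans ci≡cj (c≗d j)))

  colourable? : U.Decidable Colourable
  colourable? k = map′
    (λ (x , p) → finToFun x , p)
    (λ (c , p) → funToFin c , proper-resp-≗ (finToFun-funToFin c) p)
    (any? {n = k ^ n} (proper? ∘ finToFun))

  colourable-n : Colourable n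
  colourable-n = id , λ i j a i≡j → irrefl i≡j a

least : ∀ {P : U.Pred ℕ 0ℓ} → U.Decidable P → ∀ m → P m →
        ∃[ k ] P k × (∀ j → P j → k ≤ j)
least P? zero    p = zero , p , λ _ _ → z≤n
least {P} P? (suc m) p with P? zero
... | yes p₀ = zero , p₀ , λ _ _ → z≤n
... | no ¬p₀ with least (P? ∘ suc) m p
...   | k , pk , min = suc k , pk , min′
  where
  min′ : ∀ j → P j → suc k ≤ j
  min′ zero    q = contradiction q ¬p₀
  min′ (suc j) q = s≤s (min j q)

module _ {n : ℕ} (G : Graph n) where

  leastColouring : ∃[ k ] Colourable G k × (∀ j → Colourable G j → k ≤ j)
  leastColouring = least (colourable? G) n (colourable-n G)

  χ : ℕ
  χ = proj₁ leastColouring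

  χ-colourable : Colourable G χ
  χ-colourable = proj₁ (proj₂ leastColouring)

  χ-minimal : ∀ k → Colourable G k → χ ≤ k
  χ-minimal = proj₂ (proj₂ leastColouring)

{-# OPTIONS --safe #-}
module Submission where

-- Put m = r - 2 and choose a natural q with n^m ≤ q · (number of K_m in N(u) ∩ N(v)) for all
-- non-adjacent u ≠ v.  Adjacent vertices have no K_m in their common neighbourhood, as G is
-- K_r-free.  So if T is a collection of m-sets, w is not adjacent to u whenever some clique of T
-- lies in N(u) ∩ N(w), and a T of bounded size chosen greedily detects nearly all
-- non-adjacencies at any prescribed list of vertices.  Since what T detects at u depends only on
-- the trace {S ∈ T : S ⊆ N(u)}, two vertices with equal trace and few undetected
-- non-adjacencies have neighbourhoods of small symmetric difference; by pigeonhole, a list of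
-- vertices whose neighbourhoods pairwise differ by at least n / L has bounded length.
--
-- Take a maximal such list.  Two adjacent vertices u, v cannot both be close to the same member
-- of it: N(u) contains at least n^m / q cliques K_m, none of them inside N(v), while only
-- ∣N(u) ─ N(v)∣ · n^(m-1) sets of size m meet N(u) ─ N(v).  So the members of the list serve as
-- colours.  This argument needs u to have a non-neighbour; the fewer than r universal vertices
-- form a clique and get their own colours.

open import Defs
open import Data.Nat
  using (ℕ; zero; suc; _+_; _*_; _∸_; _^_; _≤_; _<_; _≥_; z≤n; s≤s;
         NonZero; >-nonZero; >-nonZero⁻¹; _<?_; _≤?_)
import Data.Nat as ℕ
open import Data.Nat.ListAction using (sum)
open import Data.Nat.Properties hiding (_≟_)
open import Algebra.Properties.CommutativeSemigroup +-commutativeSemigroup using (x∙yz≈y∙xz)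
open import Data.Nat.Tactic.RingSolver using (solve-∀)
open import Data.Bool using (true; false)
open import Data.Fin using (Fin; zero; suc)
import Data.Fin as Fin
open import Data.Fin.Base using (funToFin; finToFun)
open import Data.Fin.Properties using (all?; any?; _≟_; pigeonhole; finToFun-funToFin)
open import Data.Fin.Subset
  using (Subset; inside; outside; Nonempty; ⊥; ⁅_⁆; _∈_; _∉_; _⊆_; _∩_; _∪_; _─_; ∣_∣)
open import Data.Fin.Subset.Properties
  using (_∈?_; _⊆?_; nonempty?; ∪-identityˡ; ∣⊥∣≡0; ∉⊥; x∈⁅y⁆⇒x≡y; x∈p∩q⁺; x∈p∩q⁻; x∈p∪q⁺; x∈p∪q⁻;
         p─q⊆p; x∈p∧x∉q⇒x∈p─q; x∈p⇒∣p-x∣<∣p∣)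
import Data.Integer as ℤ
import Data.Integer.Properties as ℤ
open import Data.List
  using (List; []; _∷_; _++_; map; filter; length; cartesianProduct; allFin; tabulate; lookup)
open import Data.List.Membership.Propositional.Properties using (∈-filter⁺; ∈-allFin; ∈-lookup)
open import Data.List.Properties
  using (length-filter; length-++; length-map; length-tabulate; length-take; filter-++; filter-none)
open import Data.List.Relation.Binary.Sublist.Heterogeneous.Properties
  using (⊆-filter-Sublist; length-mono-≤)
open import Data.List.Relation.Binary.Sublist.Propositional using (⊆-refl)
open import Data.List.Relation.Unary.All as All using (All; []; _∷_)
import Data.List.Relation.Unary.All.Properties as All
open import Data.List.Relation.Unary.AllPairs using (AllPairs; []; _∷_)
import Data.List.Relation.Unary.AllPairs.Properties as AllPairs
open import Data.List.Relation.Unary.Any as Any using (Any; here; there)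
import Data.List.Relation.Unary.Any.Properties as Any
import Data.List.Relation.Unary.Unique.Propositional.Properties as Unique
open import Data.Product using (∃-syntax; _×_; _,_; proj₁; proj₂)
open import Data.Rational using (mkℚ)
import Data.Rational as ℚ
import Data.Rational.Properties as ℚ
open import Data.Rational.Unnormalised using (mkℚᵘ)
import Data.Rational.Unnormalised as ℚᵘ
import Data.Rational.Unnormalised.Properties as ℚᵘ
open import Data.Sum using (_⊎_; inj₁; inj₂)
open import Data.Vec as Vec using (here; there)
import Data.Vec.Functional as F
open import Data.Vec.Properties using (lookup⇒[]=; []=⇒lookup; lookup∘tabulate)
open import Function using (_∘_; id)
open import Level using (0ℓ)
open import Relation.Binary using (Rel)
import Relation.Binary as B
open import Relation.Binary.PropositionalEquality
  using (_≡_; _≢_; refl; sym; setoid; trans; cong; cong₂; subst; subst₂)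
open import Relation.Nullary using (¬_; Dec; yes; no; does; contradiction)
open import Relation.Nullary.Decidable using (¬?; _×-dec_; dec-true; decidable-stable)
open import Relation.Unary using (Pred; Decidable)

-- Counting and averaging over lists.

module _ {A : Set} where

  count : {P : Pred A 0ℓ} → Decidable P → List A → ℕ
  count P? xs = length (filter P? xs)

  count-mono : {P Q : Pred A 0ℓ} (P? : Decidable P) (Q? : Decidable Q) →
               (∀ {x} → P x → Q x) → ∀ xs → count P? xs ≤ count Q? xs
  count-mono P? Q? P⇒Q xs =
    length-mono-≤ (⊆-filter-Sublist P? Q? (λ { refl → P⇒Q }) (⊆-refl {x = xs}))

  count-filter : {P Q R : Pred A 0ℓ}
                 (P? : Decidable P) (Q? : Decidable Q) (R? : Decidable R) →
                 (∀ {x} → P x → Q x) → (∀ {x} → P x → R x) →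
                 ∀ xs → count P? xs ≤ count Q? (filter R? xs)
  count-filter P? Q? R? P⇒Q P⇒R [] = z≤n
  count-filter P? Q? R? P⇒Q P⇒R (x ∷ xs) with P? x | R? x
  ... | yes p | no ¬r = contradiction (P⇒R p) ¬r
  ... | no _  | no _  = count-filter P? Q? R? P⇒Q P⇒R xs
  ... | yes p | yes _ with Q? x
  ...   | yes _ = s≤s (count-filter P? Q? R? P⇒Q P⇒R xs)
  ...   | no ¬q = contradiction (P⇒Q p) ¬q
  count-filter P? Q? R? P⇒Q P⇒R (x ∷ xs) | no _ | yes _ with does (Q? x)
  ...   | true  = m≤n⇒m≤1+n (count-filter P? Q? R? P⇒Q P⇒R xs)
  ...   | false = count-filter P? Q? R? P⇒Q P⇒R xs

  count-complement : {P : Pred A 0ℓ} (P? : Decidable P) → ∀ xs →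
                     count P? xs + count (¬? ∘ P?) xs ≡ length xs
  count-complement P? [] = refl
  count-complement P? (x ∷ xs) with does (P? x)
  ... | true  = cong suc (count-complement P? xs)
  ... | false = trans (+-suc _ _) (cong suc (count-complement P? xs))

  count-none : {P : Pred A 0ℓ} (P? : Decidable P) → (∀ x → ¬ P x) → ∀ xs → count P? xs ≡ 0
  count-none P? ¬P xs = cong length (filter-none P? (All.universal ¬P xs))

  count-++ : {P : Pred A 0ℓ} (P? : Decidable P) → ∀ xs ys →
             count P? (xs ++ ys) ≡ count P? xs + count P? ys
  count-++ P? xs ys = trans (cong length (filter-++ P? xs ys)) (length-++ (filter P? xs))

  sum-*ˡ : ∀ k (f : A → ℕ) xs → sum (map (λ x → k * f x) xs) ≡ k * sum (map f xs)
  sum-*ˡ k f []       = sym (*-zeroʳ k)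
  sum-*ˡ k f (x ∷ xs) = trans (cong (k * f x +_) (sum-*ˡ k f xs)) (sym (*-distribˡ-+ k _ _))

  markov : {P : Pred A 0ℓ} (P? : Decidable P) (f : A → ℕ) → ∀ n →
           (∀ {x} → P x → n ≤ f x) → ∀ xs → count P? xs * n ≤ sum (map f xs)
  markov P? f n P⇒n≤f [] = z≤n
  markov P? f n P⇒n≤f (x ∷ xs) with P? x
  ... | yes px = +-mono-≤ (P⇒n≤f px) (markov P? f n P⇒n≤f xs)
  ... | no _   = m≤n⇒m≤o+n (f x) (markov P? f n P⇒n≤f xs)

  sum≤length*max : ∀ (f : A → ℕ) (x₀ : A) xs →
                   ∃[ x ] sum (map f xs) ≤ length xs * f x
  -- `x₀` serves as the default witness when there is nothing to maximise over.
  sum≤length*max f x₀ [] = x₀ , z≤n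
  sum≤length*max f x₀ (y ∷ ys) with sum≤length*max f x₀ ys
  ... | x , bound with ≤-total (f x) (f y)
  ...   | inj₁ fx≤fy = y , +-monoʳ-≤ (f y) (≤-trans bound (*-monoʳ-≤ (length ys) fx≤fy))
  ...   | inj₂ fy≤fx = x , +-mono-≤ fy≤fx bound

  *-length≤sum : ∀ (f : A → ℕ) N xs → All (λ x → N ≤ f x) xs →
                 length xs * N ≤ sum (map f xs)
  *-length≤sum f N []       []         = z≤n
  *-length≤sum f N (x ∷ xs) (px ∷ pxs) = +-mono-≤ px (*-length≤sum f N xs pxs)

module _ {A B : Set} where

  count-map : {P : Pred B 0ℓ} (P? : Decidable P) (f : A → B) → ∀ xs →
              count P? (map f xs) ≡ count (P? ∘ f) xs
  count-map P? f [] = refl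
  count-map P? f (x ∷ xs) with does (P? (f x))
  ... | true  = cong suc (count-map P? f xs)
  ... | false = count-map P? f xs

module _ {A B : Set} where

  count-cartesianProduct : {P : Pred (A × B) 0ℓ} (P? : Decidable P) → ∀ xs ys →
    count P? (cartesianProduct xs ys) ≡ sum (map (λ x → count (P? ∘ (x ,_)) ys) xs)
  count-cartesianProduct P? [] ys = refl
  count-cartesianProduct P? (x ∷ xs) ys = trans
    (count-++ P? (map (x ,_) ys) _)
    (cong₂ _+_ (count-map P? (x ,_) ys) (count-cartesianProduct P? xs ys))

  length-cartesianProduct : ∀ (xs : List A) (ys : List B) →
    length (cartesianProduct xs ys) ≡ length xs * length ys
  length-cartesianProduct [] ys = refl
  length-cartesianProduct (x ∷ xs) ys = trans
    (length-++ (map (x ,_) ys))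
    (cong₂ _+_ (length-map (x ,_) ys) (length-cartesianProduct xs ys))

  -- Double counting and greedy sampling.

  module _ {H : A → B → Set} (H? : ∀ a b → Dec (H a b)) where

    double-count : ∀ xs ys →
      sum (map (λ x → count (H? x) ys) xs) ≡
      sum (map (λ y → count (λ x → H? x y) xs) ys)
    double-count [] ys = sym (zeros ys)
      where
      zeros : ∀ ys → sum (map (λ y → count (λ x → H? x y) []) ys) ≡ 0
      zeros []       = refl
      zeros (_ ∷ ys) = zeros ys
    double-count (x ∷ xs) ys =
      trans (cong (count (H? x) ys +_) (double-count xs ys)) (add-row ys)
      where
      add-row : ∀ ys →
        count (H? x) ys + sum (map (λ y → count (λ x → H? x y) xs) ys) ≡
        sum (map (λ y → count (λ x → H? x y) (x ∷ xs)) ys)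
      add-row [] = refl
      add-row (y ∷ ys) with swap ← x∙yz≈y∙xz (count (H? x) ys) (count (λ x → H? x y) xs)
                          | does (H? x y)
      ... | true  = cong suc (trans (swap _) (cong (_ +_) (add-row ys)))
      ... | false = trans (swap _) (cong (_ +_) (add-row ys))

    missed? : ∀ {s} (T : Fin s → B) → Decidable (λ x → ∀ i → ¬ H x (T i))
    missed? T x = all? λ i → ¬? (H? x (T i))

    module _ (ys : List B) (y₀ : B) (N q : ℕ) .{{_ : NonZero N}} .{{_ : NonZero q}}
             (|ys|≤N : length ys ≤ N) where

      Dense : Pred A 0ℓ
      Dense x = N ≤ q * count (H? x) ys

      -- Density gives at least `length xs * N / q` related pairs. They are shared among at most `N`
      -- members of `ys`, so some `y` takes part in at least `length xs / q` of them.
      popular : ∀ xs → All Dense xs → ∃[ y ] length xs ≤ q * count (λ x → H? x y) xs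
      popular xs dense with sum≤length*max (λ y → count (λ x → H? x y) xs) y₀ ys
      ... | y , bound = y , *-cancelʳ-≤ _ _ N (begin
        length xs * N
          ≤⟨ *-length≤sum (λ x → q * count (H? x) ys) N xs dense ⟩
        sum (map (λ x → q * count (H? x) ys) xs)
          ≡⟨ sum-*ˡ q (λ x → count (H? x) ys) xs ⟩
        q * sum (map (λ x → count (H? x) ys) xs)
          ≡⟨ cong (q *_) (double-count xs ys) ⟩
        q * sum (map (λ y → count (λ x → H? x y) xs) ys)
          ≤⟨ *-monoʳ-≤ q bound ⟩
        q * (length ys * hits)
          ≤⟨ *-monoʳ-≤ q (*-monoˡ-≤ hits |ys|≤N) ⟩
        q * (N * hits)
          ≡⟨ rearrange q N hits ⟩
        q * hits * N ∎)
        where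
        open ≤-Reasoning
        hits : ℕ
        hits = count (λ x → H? x y) xs
        rearrange : ∀ a b c → a * (b * c) ≡ a * c * b
        rearrange = solve-∀

      -- Each greedy choice leaves at most a (1 - 1/q)-fraction of the missed elements, and
      -- (1 - 1/q)^s ≤ q / (q + s).
      greedy-sample : ∀ s xs → All Dense xs →
        ∃[ T ] (q + s) * count (missed? {s} T) xs ≤ q * length xs
      greedy-sample zero xs dense =
        (λ ()) , *-mono-≤ (≤-reflexive (+-identityʳ q)) (length-filter (missed? (λ ())) xs)
      greedy-sample (suc s) xs dense with popular xs dense
      ... | y , hit with greedy-sample s (filter (λ x → ¬? (H? x y)) xs) (All.filter⁺ _ dense)
      ...   | T , ih = y F.∷ T , goal
        where
        open ≤-Reasoning
        q+s≢0 : NonZero (q + s)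
        q+s≢0 = >-nonZero (<-≤-trans (>-nonZero⁻¹ q) (m≤m+n q s))

        h p x : ℕ
        h = count (λ x → H? x y) xs
        p = count (λ x → ¬? (H? x y)) xs
        x = count (missed? (y F.∷ T)) xs

        h+p : h + p ≡ length xs
        h+p = count-complement (λ x → H? x y) xs

        x≤ : x ≤ count (missed? T) (filter (λ x → ¬? (H? x y)) xs)
        x≤ = count-filter _ _ _ (λ m i → m (suc i)) (λ m → m zero) xs

        -- Raising the factor from `q + s` to `q + s + 1` adds one more `x`, which is at most
        -- `q * p / (q + s)` by induction and hence at most `q * h` by this bound. `cancel` carries
        -- this out multiplied by `Q = q + s`, without division.
        p≤ : p ≤ (q + s) * h
        p≤ = begin
          p           ≤⟨ m≤n+m p h ⟩
          h + p       ≡⟨ h+p ⟩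
          length xs   ≤⟨ hit ⟩
          q * h       ≤⟨ *-monoˡ-≤ h (m≤m+n q s) ⟩
          (q + s) * h ∎

        cancel : ∀ Q .{{_ : NonZero Q}} → Q * x ≤ q * p → p ≤ Q * h → suc Q * x ≤ q * (h + p)
        cancel Q Qx≤ p≤Qh = *-cancelˡ-≤ Q (begin
          Q * (suc Q * x)       ≡⟨ e₁ Q x ⟩
          suc Q * (Q * x)       ≤⟨ *-monoʳ-≤ (suc Q) Qx≤ ⟩
          suc Q * (q * p)       ≡⟨ e₂ Q q p ⟩
          q * (p + Q * p)       ≤⟨ *-monoʳ-≤ q (+-monoˡ-≤ (Q * p) p≤Qh) ⟩
          q * (Q * h + Q * p)   ≡⟨ e₃ q Q h p ⟩
          Q * (q * (h + p))     ∎)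
          where
          e₁ : ∀ Q x → Q * (suc Q * x) ≡ suc Q * (Q * x)
          e₁ = solve-∀
          e₂ : ∀ Q q p → suc Q * (q * p) ≡ q * (p + Q * p)
          e₂ = solve-∀
          e₃ : ∀ q Q h p → q * (Q * h + Q * p) ≡ Q * (q * (h + p))
          e₃ = solve-∀

        goal : (q + suc s) * x ≤ q * length xs
        goal = subst (λ l → (q + suc s) * x ≤ q * l) h+p
          (subst (λ k → k * x ≤ q * (h + p)) (sym (+-suc q s))
            (cancel (q + s) {{q+s≢0}} (≤-trans (*-monoʳ-≤ (q + s) x≤) ih) p≤))

-- Sizes of subsets and numbers of subsets of a given size.

-- The function `f` is arbitrary because the induction passes to `f ∘ suc`; the use is with `id`, to
-- compare a subset with a count over `allFin`.
∣p∣≤count-tabulate : ∀ {A : Set} {P : Pred A 0ℓ} (P? : Decidable P) {n}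
                     (S : Subset n) (f : Fin n → A) →
                     (∀ {i} → i ∈ S → P (f i)) → ∣ S ∣ ≤ count P? (tabulate f)
∣p∣≤count-tabulate P? Vec.[] f S⇒P = z≤n
∣p∣≤count-tabulate P? (inside Vec.∷ S) f S⇒P with P? (f zero)
... | yes _ = s≤s (∣p∣≤count-tabulate P? S (f ∘ suc) (S⇒P ∘ there))
... | no ¬p = contradiction (S⇒P here) ¬p
∣p∣≤count-tabulate P? (outside Vec.∷ S) f S⇒P with P? (f zero)
... | yes _ = m≤n⇒m≤1+n (∣p∣≤count-tabulate P? S (f ∘ suc) (S⇒P ∘ there))
... | no _  = ∣p∣≤count-tabulate P? S (f ∘ suc) (S⇒P ∘ there)

∣p∪q∣≤∣p∣+∣q∣ : ∀ {n} (p q : Subset n) → ∣ p ∪ q ∣ ≤ ∣ p ∣ + ∣ q ∣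
∣p∪q∣≤∣p∣+∣q∣ Vec.[] Vec.[] = z≤n
∣p∪q∣≤∣p∣+∣q∣ (inside Vec.∷ p) (inside Vec.∷ q) =
  s≤s (≤-trans (∣p∪q∣≤∣p∣+∣q∣ p q) (+-monoʳ-≤ ∣ p ∣ (n≤1+n ∣ q ∣)))
∣p∪q∣≤∣p∣+∣q∣ (inside Vec.∷ p) (outside Vec.∷ q) = s≤s (∣p∪q∣≤∣p∣+∣q∣ p q)
∣p∪q∣≤∣p∣+∣q∣ (outside Vec.∷ p) (inside Vec.∷ q) =
  ≤-trans (s≤s (∣p∪q∣≤∣p∣+∣q∣ p q)) (≤-reflexive (sym (+-suc ∣ p ∣ ∣ q ∣)))
∣p∪q∣≤∣p∣+∣q∣ (outside Vec.∷ p) (outside Vec.∷ q) = ∣p∪q∣≤∣p∣+∣q∣ p q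

x∉p⇒∣⁅x⁆∪p∣≡1+∣p∣ : ∀ {n} {x : Fin n} (p : Subset n) → x ∉ p → ∣ ⁅ x ⁆ ∪ p ∣ ≡ suc ∣ p ∣
x∉p⇒∣⁅x⁆∪p∣≡1+∣p∣ {x = zero}  (inside  Vec.∷ p) x∉p = contradiction here x∉p
x∉p⇒∣⁅x⁆∪p∣≡1+∣p∣ {x = zero}  (outside Vec.∷ p) x∉p = cong (suc ∘ ∣_∣) (∪-identityˡ p)
x∉p⇒∣⁅x⁆∪p∣≡1+∣p∣ {x = suc x} (inside  Vec.∷ p) x∉p =
  cong suc (x∉p⇒∣⁅x⁆∪p∣≡1+∣p∣ p (x∉p ∘ there))
x∉p⇒∣⁅x⁆∪p∣≡1+∣p∣ {x = suc x} (outside Vec.∷ p) x∉p =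
  x∉p⇒∣⁅x⁆∪p∣≡1+∣p∣ p (x∉p ∘ there)

count-subsets-suc : ∀ {n} {P : Pred (Subset (suc n)) 0ℓ} (P? : Decidable P) →
  count P? (subsets (suc n)) ≡
  count (P? ∘ (inside Vec.∷_)) (subsets n) + count (P? ∘ (outside Vec.∷_)) (subsets n)
count-subsets-suc {n} P? = trans
  (count-++ P? (map (inside Vec.∷_) (subsets n)) _)
  (cong₂ _+_ (count-map P? _ (subsets n)) (count-map P? _ (subsets n)))

hasSize? : ∀ {n} k → Decidable (λ (S : Subset n) → ∣ S ∣ ≡ k)
hasSize? k S = ∣ S ∣ ℕ.≟ k

Meets : ∀ {n} → Subset n → ℕ → Pred (Subset n) 0ℓ
Meets D k S = ∣ S ∣ ≡ k × Nonempty (S ∩ D)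

meets? : ∀ {n} (D : Subset n) k → Decidable (Meets D k)
meets? D k S = hasSize? k S ×-dec nonempty? (S ∩ D)

-- Pascal's recursion, with the power `n ^ k` as a crude bound for the binomial coefficient.
count-hasSize : ∀ n k → count (hasSize? k) (subsets n) ≤ n ^ k
count-hasSize zero    zero    = ≤-refl
count-hasSize zero    (suc k) = z≤n
count-hasSize (suc n) zero    = begin
  count (hasSize? 0) (subsets (suc n))
    ≡⟨ count-subsets-suc {n} (hasSize? 0) ⟩
  count (hasSize? 0 ∘ (inside Vec.∷_)) (subsets n) + count (hasSize? 0) (subsets n)
    ≡⟨ cong (_+ count (hasSize? 0) (subsets n)) (count-none _ (λ _ ()) (subsets n)) ⟩
  count (hasSize? 0) (subsets n)
    ≤⟨ count-hasSize n 0 ⟩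
  1 ∎
  where open ≤-Reasoning
count-hasSize (suc n) (suc k) = begin
  count (hasSize? (suc k)) (subsets (suc n))
    ≡⟨ count-subsets-suc {n} (hasSize? (suc k)) ⟩
  count (hasSize? (suc k) ∘ (inside Vec.∷_)) (subsets n) + count (hasSize? (suc k)) (subsets n)
    ≤⟨ +-mono-≤ (count-mono _ (hasSize? k) suc-injective (subsets n)) ≤-refl ⟩
  count (hasSize? k) (subsets n) + count (hasSize? (suc k)) (subsets n)
    ≤⟨ +-mono-≤ (count-hasSize n k) (count-hasSize n (suc k)) ⟩
  suc n * n ^ k
    ≤⟨ *-monoʳ-≤ (suc n) (^-monoˡ-≤ k (n≤1+n n)) ⟩
  suc n * suc n ^ k ∎
  where open ≤-Reasoning

-- Heuristically, choose an element of `D` and then `k` further elements. The proof splits on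
-- whether the set contains the first vertex, as in Pascal's recursion.
count-meets : ∀ {n} (D : Subset n) k → count (meets? D (suc k)) (subsets n) ≤ ∣ D ∣ * n ^ k
count-meets Vec.[] k = z≤n
count-meets {suc n} (inside Vec.∷ D) k = begin
  count (meets? (inside Vec.∷ D) (suc k)) (subsets (suc n))
    ≡⟨ count-subsets-suc {n} (meets? (inside Vec.∷ D) (suc k)) ⟩
  _ + count (meets? (inside Vec.∷ D) (suc k) ∘ (outside Vec.∷_)) (subsets n)
    ≤⟨ +-mono-≤ (count-mono _ (hasSize? k) (suc-injective ∘ proj₁) (subsets n))
                (count-mono _ (meets? D (suc k)) (λ { (e , suc i , there m) → e , i , m }) (subsets n)) ⟩
  count (hasSize? k) (subsets n) + count (meets? D (suc k)) (subsets n)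
    ≤⟨ +-mono-≤ (count-hasSize n k) (count-meets D k) ⟩
  suc ∣ D ∣ * n ^ k
    ≤⟨ *-monoʳ-≤ (suc ∣ D ∣) (^-monoˡ-≤ k (n≤1+n n)) ⟩
  suc ∣ D ∣ * suc n ^ k ∎
  where open ≤-Reasoning
count-meets {suc n} (outside Vec.∷ D) k = begin
  count (meets? (outside Vec.∷ D) (suc k)) (subsets (suc n))
    ≡⟨ count-subsets-suc {n} (meets? (outside Vec.∷ D) (suc k)) ⟩
  _ + count (meets? (outside Vec.∷ D) (suc k) ∘ (outside Vec.∷_)) (subsets n)
    ≤⟨ +-mono-≤ (count-mono _ (meets? D k)
                  (λ { (e , suc i , there m) → suc-injective e , i , m }) (subsets n))
                (count-mono _ (meets? D (suc k)) (λ { (e , suc i , there m) → e , i , m }) (subsets n)) ⟩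
  count (meets? D k) (subsets n) + count (meets? D (suc k)) (subsets n)
    ≤⟨ total k ⟩
  ∣ D ∣ * suc n ^ k ∎
  where
  open ≤-Reasoning
  -- A set containing the first vertex has `k` elements left, and the induction hypothesis speaks of
  -- positive sizes only. For `k = 0` the remainder is empty and meets nothing.
  total : ∀ k → count (meets? D k) (subsets n) + count (meets? D (suc k)) (subsets n) ≤
                ∣ D ∣ * suc n ^ k
  total zero = begin
    count (meets? D 0) (subsets n) + count (meets? D 1) (subsets n)
      ≡⟨ cong (_+ count (meets? D 1) (subsets n)) (count-none (meets? D 0) empty-misses (subsets n)) ⟩
    count (meets? D 1) (subsets n)
      ≤⟨ count-meets D 0 ⟩
    ∣ D ∣ * 1 ∎
    where
    empty-misses : ∀ S → ¬ Meets D 0 S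
    empty-misses S (∣S∣≡0 , i , i∈S∩D) =
      n≮0 (subst (0 <_) ∣S∣≡0 (x∈p⇒0<∣p∣ (proj₁ (x∈p∩q⁻ S D i∈S∩D))))
      where
      x∈p⇒0<∣p∣ : ∀ {n x} {p : Subset n} → x ∈ p → 0 < ∣ p ∣
      x∈p⇒0<∣p∣ x∈p = ≤-<-trans z≤n (x∈p⇒∣p-x∣<∣p∣ x∈p)
  total (suc k) = begin
    count (meets? D (suc k)) (subsets n) + count (meets? D (suc (suc k))) (subsets n)
      ≤⟨ +-mono-≤ (count-meets D k) (count-meets D (suc k)) ⟩
    ∣ D ∣ * n ^ k + ∣ D ∣ * (n * n ^ k)
      ≡⟨ *-distribˡ-+ ∣ D ∣ (n ^ k) (n * n ^ k) ⟨
    ∣ D ∣ * (suc n * n ^ k)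
      ≤⟨ *-monoʳ-≤ ∣ D ∣ (*-monoʳ-≤ (suc n) (^-monoˡ-≤ k (n≤1+n n))) ⟩
    ∣ D ∣ * (suc n * suc n ^ k) ∎

-- Greedily chosen separated lists.

module _ {A : Set} {R : Rel A 0ℓ} (R? : B.Decidable R) where

  separate : List A → List A
  separate [] = []
  separate (x ∷ xs) with Any.any? (R? x) (separate xs)
  ... | yes _ = separate xs
  ... | no _  = x ∷ separate xs

  separate-separated : ∀ xs → AllPairs (λ x y → ¬ R x y) (separate xs)
  separate-separated [] = []
  separate-separated (x ∷ xs) with Any.any? (R? x) (separate xs)
  ... | yes _ = separate-separated xs
  ... | no ¬a = All.tabulate (λ y∈ Rxy → ¬a (Any.map (λ { refl → Rxy }) y∈)) ∷ separate-separated xs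

  separate-All : ∀ {P : Pred A 0ℓ} {xs} → All P xs → All P (separate xs)
  separate-All [] = []
  separate-All {xs = x ∷ xs} (px ∷ pxs) with Any.any? (R? x) (separate xs)
  ... | yes _ = separate-All pxs
  ... | no _  = px ∷ separate-All pxs

  -- An element is either kept, and then related to itself, or dropped precisely because it is
  -- related to one already kept.
  separate-covers : (∀ x → R x x) → ∀ {x xs} → Any (x ≡_) xs → Any (R x) (separate xs)
  separate-covers R-refl {x} {y ∷ ys} x∈ with Any.any? (R? y) (separate ys) | x∈
  ... | yes a | here refl = a
  ... | yes _ | there x∈′ = separate-covers R-refl x∈′
  ... | no _  | here refl = here (R-refl x)
  ... | no _  | there x∈′ = there (separate-covers R-refl x∈′)

AllPairs-lookup : ∀ {A : Set} {R : Rel A 0ℓ} {xs} → AllPairs R xs →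
                  ∀ {i j} → i Fin.< j → R (lookup xs i) (lookup xs j)
AllPairs-lookup {xs = x ∷ xs} (rx ∷ _) {zero} {suc j} _ = All.lookup rx (∈-lookup j)
AllPairs-lookup (_ ∷ rs) {suc i} {suc j} (s≤s i<j) = AllPairs-lookup rs i<j

bit : ∀ {A : Set} → Dec A → Fin 2
bit (yes _) = suc zero
bit (no _)  = zero

bit-≡ : ∀ {A B : Set} (A? : Dec A) (B? : Dec B) → bit A? ≡ bit B? → A → B
bit-≡ (yes _) (yes b) _ _ = b
bit-≡ (no ¬a) _       _ a = contradiction a ¬a

-- Cliques and colourings.

module _ {n : ℕ} (G : Graph n) where
  open Graph G

  ∈N⁺ : ∀ {u v} → Adj u v → v ∈ N G u
  ∈N⁺ {u} {v} a = lookup⇒[]= v _ (trans (lookup∘tabulate _ v) (dec-true (adj? u v) a))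

  ∈N⁻ : ∀ {u v} → v ∈ N G u → Adj u v
  ∈N⁻ {u} {v} v∈ with adj? u v | trans (sym (lookup∘tabulate (λ v → does (adj? u v)) v)) ([]=⇒lookup v∈)
  ... | yes a | _  = a
  ... | no _  | ()

  clique-extend : ∀ {k S v} → IsClique G k S → (∀ {i} → i ∈ S → Adj v i) →
                  IsClique G (suc k) (⁅ v ⁆ ∪ S)
  clique-extend {k} {S} {v} (∣S∣≡k , adj) v~S =
    trans (x∉p⇒∣⁅x⁆∪p∣≡1+∣p∣ S (λ v∈S → irrefl refl (v~S v∈S))) (cong suc ∣S∣≡k) , adj′
    where
    adj′ : ∀ i j → i ∈ ⁅ v ⁆ ∪ S → j ∈ ⁅ v ⁆ ∪ S → i ≢ j → Adj i j
    adj′ i j i∈ j∈ i≢j with x∈p∪q⁻ ⁅ v ⁆ S i∈ | x∈p∪q⁻ ⁅ v ⁆ S j∈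
    ... | inj₂ i∈S | inj₂ j∈S = adj i j i∈S j∈S i≢j
    ... | inj₂ i∈S | inj₁ j≡v rewrite x∈⁅y⁆⇒x≡y v j≡v = symm (v~S i∈S)
    ... | inj₁ i≡v | inj₂ j∈S rewrite x∈⁅y⁆⇒x≡y v i≡v = v~S j∈S
    ... | inj₁ i≡v | inj₁ j≡v =
      contradiction (trans (x∈⁅y⁆⇒x≡y v i≡v) (sym (x∈⁅y⁆⇒x≡y v j≡v))) i≢j

  -- Otherwise `S` together with `u` and `v` would be a clique on `2 + m` vertices.
  adjacent-no-common-clique : ∀ {m u v S} → KFree G (2 + m) → Adj u v →
    IsClique G m S → S ⊆ N G u → ¬ S ⊆ N G v
  adjacent-no-common-clique {m} {u} {v} {S} free u~v clique S⊆Nu S⊆Nv =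
    free _ (clique-extend (clique-extend clique (∈N⁻ ∘ S⊆Nv)) u~)
    where
    u~ : ∀ {i} → i ∈ ⁅ v ⁆ ∪ S → Adj u i
    u~ i∈ with x∈p∪q⁻ ⁅ v ⁆ S i∈
    ... | inj₁ i≡v rewrite x∈⁅y⁆⇒x≡y v i≡v = u~v
    ... | inj₂ i∈S = ∈N⁻ (S⊆Nu i∈S)

  -- The last component is there for the induction: it turns adjacency to every member of the list
  -- into adjacency to every member of `S`.
  list-clique : ∀ {us} → AllPairs Adj us →
                ∃[ S ] IsClique G (length us) S × (∀ {i} → i ∈ S → Any (i ≡_) us)
  list-clique [] = ⊥ , (∣⊥∣≡0 n , λ _ _ i∈⊥ → contradiction i∈⊥ ∉⊥) , λ i∈⊥ → contradiction i∈⊥ ∉⊥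
  list-clique {u ∷ us} (u~us ∷ adj) with list-clique adj
  ... | S , clique , S⊆us = ⁅ u ⁆ ∪ S , clique-extend clique (All.lookup u~us ∘ S⊆us) , ⊆
    where
    ⊆ : ∀ {i} → i ∈ ⁅ u ⁆ ∪ S → Any (i ≡_) (u ∷ us)
    ⊆ i∈ with x∈p∪q⁻ ⁅ u ⁆ S i∈
    ... | inj₁ i≡u = here (x∈⁅y⁆⇒x≡y u i≡u)
    ... | inj₂ i∈S = there (S⊆us i∈S)

  -- The colour of `v` is the position of some `z` in `zs` with `R v z`; vertices of equal colour
  -- share this `z`.
  list-colouring : ∀ {R : Rel (Fin n) 0ℓ} zs → (∀ v → Any (R v) zs) →
                   (∀ {u v z} → R u z → R v z → ¬ Adj u v) → Colourable G (length zs)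
  list-colouring {R} zs covers separated = (λ v → Any.index (covers v)) , proper
    where
    proper : Proper G (λ v → Any.index (covers v))
    proper u v u~v same = separated (Any.lookup-index (covers u))
      (subst (R v ∘ lookup zs) (sym same) (Any.lookup-index (covers v))) u~v

  -- Universal vertices and close neighbourhoods.

  NonUniversal : Pred (Fin n) 0ℓ
  NonUniversal u = ∃[ w ] u ≢ w × ¬ Adj u w

  nonUniversal? : Decidable NonUniversal
  nonUniversal? u = any? λ w → ¬? (u ≟ w) ×-dec ¬? (adj? u w)

  -- Each one-sided difference is at most `n / L`. Both sides are recorded because going from `u` to
  -- `v` through a common close vertex `z` uses one side at `u` and the other at `v`.
  Close : ℕ → Rel (Fin n) 0ℓ
  Close L u v = L * ∣ N G u ─ N G v ∣ ≤ n × L * ∣ N G v ─ N G u ∣ ≤ n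

  close? : ∀ L → B.Decidable (Close L)
  close? L u v = (L * ∣ N G u ─ N G v ∣ ≤? n) ×-dec (L * ∣ N G v ─ N G u ∣ ≤? n)

  close-refl : ∀ L u → Close L u u
  close-refl L u = bound , bound
    where
    ∣p─p∣≡0 : ∀ {n} (p : Subset n) → ∣ p ─ p ∣ ≡ 0
    ∣p─p∣≡0 Vec.[] = refl
    ∣p─p∣≡0 (inside  Vec.∷ p) = ∣p─p∣≡0 p
    ∣p─p∣≡0 (outside Vec.∷ p) = ∣p─p∣≡0 p
    bound : L * ∣ N G u ─ N G u ∣ ≤ n
    bound rewrite ∣p─p∣≡0 (N G u) | *-zeroʳ L = z≤n

  -- Detecting non-adjacency by cliques, and the length of separated lists.

  module _ (m : ℕ) where

    CommonClique : Fin n × Fin n → Pred (Subset n) 0ℓ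
    CommonClique (u , w) S = S ⊆ (N G u ∩ N G w) × IsClique G m S

    commonClique? : ∀ p → Decidable (CommonClique p)
    commonClique? (u , w) S = (S ⊆? (N G u ∩ N G w)) ×-dec isClique? G m S

    -- w = u is included, so the neighbourhood of a rich vertex itself has many cliques.
    Rich : ℕ → Pred (Fin n) 0ℓ
    Rich q u = ∀ w → ¬ Adj u w → n ^ m ≤ q * copiesIn G (N G u ∩ N G w) m

    -- The hypothesis covers every `w` except `u` itself. For `w = u`, the cliques shared with a
    -- non-neighbour `v` already lie in `N G u`.
    nonUniversal⇒rich : ∀ q →
      (∀ u v → u ≢ v → ¬ Adj u v → n ^ m ≤ q * copiesIn G (N G u ∩ N G v) m) →
      ∀ {u} → NonUniversal u → Rich q u
    nonUniversal⇒rich q dense {u} (v , u≢v , u≁v) w u≁w with u ≟ w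
    ... | no u≢w = dense u w u≢w u≁w
    ... | yes refl = ≤-trans (dense u v u≢v u≁v) (*-monoʳ-≤ q
      (count-mono (commonClique? (u , v)) (commonClique? (u , u))
        (λ (S⊆ , clique) → (λ x∈S → x∈p∩q⁺ (S⊆N S⊆ x∈S , S⊆N S⊆ x∈S)) , clique) (subsets n)))
      where
      S⊆N : ∀ {S} → S ⊆ N G u ∩ N G v → S ⊆ N G u
      S⊆N S⊆ = proj₁ ∘ x∈p∩q⁻ (N G u) (N G v) ∘ S⊆

    module _ {t : ℕ} (T : Fin t → Subset n) where

      -- w = u is allowed: that case matters when u is adjacent to a vertex of the same trace.
      MissedNonAdjacent : Pred (Fin n × Fin n) 0ℓ
      MissedNonAdjacent (u , w) = ¬ Adj u w × (∀ i → ¬ CommonClique (u , w) (T i))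

      missedNonAdjacent? : Decidable MissedNonAdjacent
      missedNonAdjacent? p@(u , w) = ¬? (adj? u w) ×-dec missed? commonClique? T p

      error : Fin n → ℕ
      error u = count (missedNonAdjacent? ∘ (u ,_)) (allFin n)

      -- The set of indices `i` with `T i ⊆ N G u`, coded as a number so that `pigeonhole` applies.
      trace : Fin n → Fin (2 ^ t)
      trace u = funToFin (λ i → bit (T i ⊆? N G u))

      trace-≡ : ∀ {u v} → trace u ≡ trace v → ∀ i → T i ⊆ N G u → T i ⊆ N G v
      trace-≡ {u} {v} eq i = bit-≡ (T i ⊆? N G u) (T i ⊆? N G v)
        (trans (sym (finToFun-funToFin _ i))
          (trans (cong (λ f → finToFun f i) eq) (finToFun-funToFin _ i)))

      -- Let `w` be in `N G u` but not in `N G v`. A clique `T i` common to `v` and `w` would, by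
      -- equality of traces, also lie in `N G u`, although `u` and `w` are adjacent. So the
      -- non-adjacency of `v` and `w` is missed.
      trace-≡⇒∣─∣≤error : KFree G (2 + m) → ∀ {u v} → trace u ≡ trace v → ∣ N G u ─ N G v ∣ ≤ error v
      trace-≡⇒∣─∣≤error free {u} {v} eq =
        ∣p∣≤count-tabulate (missedNonAdjacent? ∘ (v ,_)) (N G u ─ N G v) id λ {w} w∈ →
          (λ v~w → x∈p∧x∈q⇒x∉p─q (∈N⁺ v~w) w∈) ,
          λ { i (Ti⊆ , clique) → adjacent-no-common-clique free (∈N⁻ (p─q⊆p _ _ w∈)) clique
               (trace-≡ (sym eq) i (proj₁ ∘ x∈p∩q⁻ _ _ ∘ Ti⊆)) (proj₂ ∘ x∈p∩q⁻ _ _ ∘ Ti⊆) }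
        where
        x∈p∧x∈q⇒x∉p─q : ∀ {n x} {p q : Subset n} → x ∈ q → x ∉ p ─ q
        x∈p∧x∈q⇒x∉p─q {p = p Vec.∷ _} here ()
        x∈p∧x∈q⇒x∉p─q {p = _ Vec.∷ _} (there x∈q) (there x∈) = x∈p∧x∈q⇒x∉p─q x∈q x∈

      Bad : ℕ → Pred (Fin n) 0ℓ
      Bad L u = n < L * error u

      bad? : ∀ L → Decidable (Bad L)
      bad? L u = n <? L * error u

      -- Two vertices that are not bad and have equal traces are close, so those in a separated list
      -- have distinct traces.
      good-separated-length : KFree G (2 + m) → ∀ L zs →
                              AllPairs (λ u v → ¬ Close L u v) zs →
                              count (¬? ∘ bad? L) zs ≤ 2 ^ t
      good-separated-length free L zs sep = ≮⇒≥ λ many →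
        let goods = filter (¬? ∘ bad? L) zs
            i , j , i<j , eq = pigeonhole many (trace ∘ lookup goods)
            good : ∀ i → L * error (lookup goods i) ≤ n
            good i = ≮⇒≥ (All.lookup (All.all-filter (¬? ∘ bad? L) zs) (∈-lookup i))
        in AllPairs-lookup (AllPairs.filter⁺ (¬? ∘ bad? L) sep) i<j
             ( ≤-trans (*-monoʳ-≤ L (trace-≡⇒∣─∣≤error free eq)) (good j)
             , ≤-trans (*-monoʳ-≤ L (trace-≡⇒∣─∣≤error free (sym eq))) (good i))

    separated-length : KFree G (2 + m) →
                       ∀ q L .{{_ : NonZero n}} .{{_ : NonZero q}} .{{_ : NonZero L}} →
                       ∀ zs → All (Rich q) zs → AllPairs (λ u v → ¬ Close L u v) zs →
                       length zs ≤ 2 * 2 ^ (2 * (L * q))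
    separated-length free q L zs rich sep = bound
      where
      open ≤-Reasoning
      -- With this `t` the missed fraction `q / (q + t)` is at most `1 / (2 * L)`. The average error
      -- is then at most `n / (2 * L)`, and by Markov's inequality at most half of `zs` is bad.
      t = 2 * (L * q)
      k = length zs

      pairs = cartesianProduct zs (allFin n)
      nonAdj? : Decidable (λ ((u , w) : Fin n × Fin n) → ¬ Adj u w)
      nonAdj? (u , w) = ¬? (adj? u w)

      instance
        n^m≢0 : NonZero (n ^ m)
        n^m≢0 = m^n≢0 n m

      -- Cliques are counted among the sets of size `m` alone, because there are at most `n ^ m` of
      -- these.
      dense : All (λ p → n ^ m ≤ q * count (commonClique? p) (filter (hasSize? m) (subsets n)))
                  (filter nonAdj? pairs)
      dense = All.zipWith (λ (rich , ¬adj) → ≤-trans (rich _ ¬adj) (*-monoʳ-≤ q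
          (count-filter _ _ (hasSize? m) id (proj₁ ∘ proj₂) (subsets n))))
        ( All.filter⁺ nonAdj? (All.cartesianProduct⁺ (setoid _) (setoid _) zs (allFin n)
            (λ u∈ _ → All.lookup rich u∈))
        , All.all-filter nonAdj? pairs)

      sample = greedy-sample commonClique? (filter (hasSize? m) (subsets n)) ⊥ (n ^ m) q
                 (count-hasSize n m) t (filter nonAdj? pairs) dense
      T = proj₁ sample

      total : ℕ
      total = sum (map (error T) zs)

      total≤ : (q + t) * total ≤ q * (k * n)
      total≤ = begin
        (q + t) * total
          ≡⟨ cong ((q + t) *_) (count-cartesianProduct (missedNonAdjacent? T) zs (allFin n)) ⟨
        (q + t) * count (missedNonAdjacent? T) pairs
          ≤⟨ *-monoʳ-≤ (q + t) (count-filter (missedNonAdjacent? T) (missed? commonClique? T)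
               nonAdj? proj₂ proj₁ pairs) ⟩
        (q + t) * count (missed? commonClique? T) (filter nonAdj? pairs)
          ≤⟨ proj₂ sample ⟩
        q * length (filter nonAdj? pairs)
          ≤⟨ *-monoʳ-≤ q (length-filter nonAdj? pairs) ⟩
        q * length pairs
          ≡⟨ cong (q *_) (length-cartesianProduct zs (allFin n)) ⟩
        q * (k * length (allFin n))
          ≡⟨ cong (λ l → q * (k * l)) (length-tabulate {n = n} id) ⟩
        q * (k * n) ∎

      bads goods : ℕ
      bads = count (bad? T L) zs
      goods = count (¬? ∘ bad? T L) zs

      2*bads≤k : 2 * bads ≤ k
      2*bads≤k = *-cancelˡ-≤ (L * q * n) {{m*n≢0 (L * q) n {{m*n≢0 L q}}}} (begin
        L * q * n * (2 * bads)       ≡⟨ e₁ L q n bads ⟩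
        t * (bads * n)               ≤⟨ *-mono-≤ (m≤n+m t q)
                                          (markov (bad? T L) (λ u → L * error T u) n <⇒≤ zs) ⟩
        (q + t) * sum (map (λ u → L * error T u) zs)
                                     ≡⟨ cong ((q + t) *_) (sum-*ˡ L (error T) zs) ⟩
        (q + t) * (L * total)        ≡⟨ e₂ (q + t) L total ⟩
        L * ((q + t) * total)        ≤⟨ *-monoʳ-≤ L total≤ ⟩
        L * (q * (k * n))            ≡⟨ e₃ L q k n ⟩
        L * q * n * k                ∎)
        where
        e₁ : ∀ L q n b → L * q * n * (2 * b) ≡ 2 * (L * q) * (b * n)
        e₁ = solve-∀
        e₂ : ∀ a L b → a * (L * b) ≡ L * (a * b)
        e₂ = solve-∀
        e₃ : ∀ L q k n → L * (q * (k * n)) ≡ L * q * n * k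
        e₃ = solve-∀

      bound : k ≤ 2 * 2 ^ t
      bound = +-cancelˡ-≤ k _ _ (begin
        k + k                   ≡⟨ cong (k +_) (+-identityʳ k) ⟨
        2 * k                   ≡⟨ cong (2 *_) (count-complement (bad? T L) zs) ⟨
        2 * (bads + goods)      ≡⟨ *-distribˡ-+ 2 bads goods ⟩
        2 * bads + 2 * goods    ≤⟨ +-mono-≤ 2*bads≤k (*-monoʳ-≤ 2 (good-separated-length T free L zs sep)) ⟩
        k + 2 * 2 ^ t           ∎)

  -- Colouring by the members of a separated list.

  module _ (k q : ℕ) .{{_ : NonZero n}} .{{_ : NonZero q}} (free : KFree G (3 + k)) where

    -- If `u` and `v` were adjacent, each of the at least `n ^ (1 + k) / q` cliques inside `N G u`
    -- would meet `D`, a set of at most `2 * n / L` vertices. At most `2 * n ^ (1 + k) / L` sets of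
    -- that size do, which is too few since `L` exceeds `2 * q`.
    rich-close⇒nonadjacent : ∀ {u v z} → Rich (suc k) q u →
      Close (suc (2 * q)) u z → Close (suc (2 * q)) v z → ¬ Adj u v
    rich-close⇒nonadjacent {u} {v} {z} rich (uz , _) (_ , zv) u~v = <⇒≱ {2 * q} ≤-refl
      (*-cancelʳ-≤ L (2 * q) (n * n ^ k) (begin
        L * (n * n ^ k)
          ≤⟨ *-monoʳ-≤ L (rich u (irrefl refl)) ⟩
        L * (q * copiesIn G (N G u ∩ N G u) (suc k))
          ≤⟨ *-monoʳ-≤ L (*-monoʳ-≤ q (≤-trans (count-mono _ (meets? D (suc k)) clique-meets (subsets n))
               (count-meets D k))) ⟩
        L * (q * (∣ D ∣ * n ^ k))
          ≡⟨ e₁ L q ∣ D ∣ (n ^ k) ⟩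
        q * (L * ∣ D ∣) * n ^ k
          ≤⟨ *-monoˡ-≤ (n ^ k) (*-monoʳ-≤ q L*∣D∣≤2n) ⟩
        q * (n + n) * n ^ k
          ≡⟨ e₂ q n (n ^ k) ⟩
        2 * q * (n * n ^ k) ∎))
      where
      open ≤-Reasoning
      L = suc (2 * q)

      instance
        n^1+k≢0 : NonZero (n * n ^ k)
        n^1+k≢0 = m^n≢0 n (suc k)

      D : Subset n
      -- This contains `N G u ─ N G v`, and closeness to `z` bounds each of its two pieces.
      D = (N G u ─ N G z) ∪ (N G z ─ N G v)

      L*∣D∣≤2n : L * ∣ D ∣ ≤ n + n
      L*∣D∣≤2n = begin
        L * ∣ D ∣
          ≤⟨ *-monoʳ-≤ L (∣p∪q∣≤∣p∣+∣q∣ (N G u ─ N G z) (N G z ─ N G v)) ⟩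
        L * (∣ N G u ─ N G z ∣ + ∣ N G z ─ N G v ∣)
          ≡⟨ *-distribˡ-+ L (∣ N G u ─ N G z ∣) _ ⟩
        L * ∣ N G u ─ N G z ∣ + L * ∣ N G z ─ N G v ∣
          ≤⟨ +-mono-≤ uz zv ⟩
        n + n ∎

      clique-meets : ∀ {S} → S ⊆ (N G u ∩ N G u) × IsClique G (suc k) S → Meets D (suc k) S
      clique-meets {S} (S⊆ , clique) = proj₁ clique , decidable-stable (nonempty? (S ∩ D)) λ misses →
        adjacent-no-common-clique free u~v clique S⊆Nu λ {x} x∈S →
          decidable-stable (x ∈? N G v) λ x∉Nv →
          misses (x , x∈p∩q⁺ (x∈S , (x∈p∪q⁺ (first x∈S x∉Nv))))
        where
        S⊆Nu : S ⊆ N G u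
        S⊆Nu = proj₁ ∘ x∈p∩q⁻ _ _ ∘ S⊆
        first : ∀ {x} → x ∈ S → x ∉ N G v → x ∈ N G u ─ N G z ⊎ x ∈ N G z ─ N G v
        first {x} x∈S x∉Nv with x ∈? N G z
        ... | yes x∈Nz = inj₂ (x∈p∧x∉q⇒x∈p─q x∈Nz x∉Nv)
        ... | no x∉Nz  = inj₁ (x∈p∧x∉q⇒x∈p─q (S⊆Nu x∈S) x∉Nz)

      e₁ : ∀ L q d x → L * (q * (d * x)) ≡ q * (L * d) * x
      e₁ = solve-∀
      e₂ : ∀ q n x → q * (n + n) * x ≡ 2 * q * (n * x)
      e₂ = solve-∀

    χ-bound : (∀ {u} → NonUniversal u → Rich (suc k) q u) →
              χ G ≤ (3 + k) + 2 * 2 ^ (2 * (suc (2 * q) * q))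
    χ-bound rich = ≤-trans (χ-minimal G _ (list-colouring {SameColour} (us ++ zs) covers separated))
      (≤-trans (≤-reflexive (length-++ us)) (+-mono-≤ (<⇒≤ us-short)
        (separated-length (suc k) free q L zs zs-rich (separate-separated (close? L) nonUniversals))))
      where
      L = suc (2 * q)

      us nonUniversals zs : List (Fin n)
      us = filter (¬? ∘ nonUniversal?) (allFin n)
      nonUniversals = filter nonUniversal? (allFin n)
      zs = separate (close? L) nonUniversals

      -- The first disjunct serves the universal vertices, which may be adjacent and close to
      -- each other: each of them gets its own colour.
      SameColour : Rel (Fin n) 0ℓ
      SameColour u z = u ≡ z ⊎ NonUniversal u × Close L u z

      same⇒close : ∀ {u z} → SameColour u z → Close L u z
      same⇒close (inj₁ refl)    = close-refl L _
      same⇒close (inj₂ (_ , c)) = c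

      covers : ∀ v → Any (SameColour v) (us ++ zs)
      covers v with nonUniversal? v
      ... | yes nu = Any.++⁺ʳ us (Any.map (λ c → inj₂ (nu , c))
        (separate-covers (close? L) (close-refl L) (∈-filter⁺ nonUniversal? (∈-allFin v) nu)))
      ... | no ¬nu = Any.++⁺ˡ (Any.map inj₁ (∈-filter⁺ (¬? ∘ nonUniversal?) (∈-allFin v) ¬nu))

      separated : ∀ {u v z} → SameColour u z → SameColour v z → ¬ Adj u v
      separated (inj₁ refl) (inj₁ refl) u~v = irrefl refl u~v
      separated (inj₂ (nu , c)) v≈z u~v = rich-close⇒nonadjacent (rich nu) c (same⇒close v≈z) u~v
      -- Richness of one endpoint suffices, so the roles of `u` and `v` are exchanged.
      separated u≈z@(inj₁ _) (inj₂ (nv , c)) u~v =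
        rich-close⇒nonadjacent (rich nv) c (same⇒close u≈z) (symm u~v)

      zs-rich : All (Rich (suc k) q) zs
      zs-rich = separate-All (close? L) (All.map rich (All.all-filter nonUniversal? (allFin n)))

      universal-clique : ∀ {xs} → AllPairs _≢_ xs → All (¬_ ∘ NonUniversal) xs → AllPairs Adj xs
      universal-clique [] [] = []
      universal-clique (x≢ ∷ distinct) (x-univ ∷ univ) =
        All.map (λ x≢w → decidable-stable (adj? _ _) λ ¬adj → x-univ (_ , x≢w , ¬adj)) x≢ ∷
        universal-clique distinct univ

      us-clique : AllPairs Adj us
      us-clique = universal-clique (Unique.filter⁺ (¬? ∘ nonUniversal?) (Unique.allFin⁺ n))
                                   (All.all-filter (¬? ∘ nonUniversal?) (allFin n))

      us-short : length us < 3 + k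
      us-short = ≰⇒> λ long →
        -- `KFree` forbids cliques of size exactly `3 + k`, hence the truncation of `us`.
        let S , clique , _ = list-clique (AllPairs.take⁺ (3 + k) us-clique)
        in free S (subst (λ l → IsClique G l S)
                    (trans (length-take (3 + k) us) (m≤n⇒m⊓n≡m long)) clique)

-- From a positive real to a natural number, and the conclusion.

-- Openness of the lower cut gives a rational strictly between `0` and `ε`. Its numerator is at
-- least 1, so it is at least the reciprocal of its denominator, which is taken as `q`.
positive-lower-bound : ∀ ε → Positive ε →
  ∃[ q ] NonZero q × (∀ m c → ε · m ≤ᴿ c → m ≤ q * c)
positive-lower-bound ε 0<ε with ℝ.lower-open ε 0<ε
... | p@(mkℚ (ℤ.+ suc a) d _) , _ , p<ε = suc d , _ , bound
  where
  bound : ∀ m c → ε · m ≤ᴿ c → m ≤ suc d * c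
  bound m c εm≤c = begin
    m                  ≤⟨ m≤m+n m (a * m) ⟩
    suc a * m          ≡⟨ *-identityʳ _ ⟨
    suc a * m * 1      ≤⟨ ℤ.drop‿+≤+ cross ⟩
    c * (suc d * 1)    ≡⟨ cong (c *_) (*-identityʳ (suc d)) ⟩
    c * suc d          ≡⟨ *-comm c (suc d) ⟩
    suc d * c          ∎
    where
    open ≤-Reasoning
    pm≤c : mkℚᵘ (ℤ.+ suc a) d ℚᵘ.* mkℚᵘ (ℤ.+ m) 0 ℚᵘ.≤ mkℚᵘ (ℤ.+ c) 0
    pm≤c = ℚᵘ.≤-respˡ-≃
      (ℚᵘ.≃-trans (ℚ.toℚᵘ-homo-* p (ℕ→ℚ m))
        (ℚᵘ.*-congˡ {mkℚᵘ (ℤ.+ suc a) d} (ℚ.toℚᵘ-fromℚᵘ (mkℚᵘ (ℤ.+ m) 0))))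
      (ℚᵘ.≤-respʳ-≃ (ℚ.toℚᵘ-fromℚᵘ (mkℚᵘ (ℤ.+ c) 0)) (ℚ.toℚᵘ-mono-≤ (εm≤c p p<ε)))
    cross : ℤ.+ (suc a * m * 1) ℤ.≤ ℤ.+ (c * (suc d * 1))
    cross = subst₂ ℤ._≤_
      (sym (trans (ℤ.pos-* (suc a * m) 1) (cong (ℤ._* ℤ.+ 1) (ℤ.pos-* (suc a) m))))
      (sym (ℤ.pos-* c (suc d * 1)))
      (ℚᵘ.drop-*≤* pm≤c)
... | mkℚ (ℤ.+ 0) d _ , ℚ.*<* (ℤ.+<+ ()) , _
... | mkℚ (ℤ.-[1+ a ]) d _ , ℚ.*<* () , _

χ-empty : (G : Graph 0) → ∀ C → χ G ≤ C
χ-empty G C = ≤-trans (χ-minimal G 0 ((λ ()) , λ ())) z≤n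

theorem1p1 : ∀ (r : ℕ) → r ≥ 3 → ∀ (ε : ℝ) → Positive ε →
    ∃[ C ] (∀ (n : ℕ) (G : Graph n) → KFree G r →
    (∀ (u v : Fin n) → u ≢ v → ¬ Graph.Adj G u v →
    ε · n ^ (r ∸ 2) ≤ᴿ copiesIn G (N G u ∩ N G v) (r ∸ 2)) →
    χ G ≤ C)
theorem1p1 (suc (suc (suc k))) (s≤s (s≤s (s≤s z≤n))) ε 0<ε =
  let q , q≢0 , bound = positive-lower-bound ε 0<ε in
  (3 + k) + 2 * 2 ^ (2 * (suc (2 * q) * q)) , λ where
    -- The counting argument cancels factors of `n`, so the empty graph is treated apart.
    zero    G _    _     → χ-empty G _
    (suc _) G free dense → χ-bound G k q {{_}} {{q≢0}} free
      (nonUniversal⇒rich G (suc k) q λ u v u≢v u≁v → bound _ _ (dense u v u≢v u≁v))
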